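{- For any isolate-free graph $G$ with maximum degree $\Delta(G)$, $$TC(G)\le \left(\frac{\Delta(G)+2}{2}\right)^2=\frac{\Delta(G)^2}{4}+\Delta(G)+1.$$
   Context: All graphs are finite and simple (no loops or multiple edges). A graph is isolate-free if it has no vertex of degree $0$. A set $T\subseteq V$ of vertices of a graph $G(V,E)$ is a total dominating set if every vertex of $V$ is adjacent to at least one vertex of $T$. Two disjoint sets $A,B\subset V$ form a total coalition if neither $A$ nor $B$ is a total dominating set, but $A\cup B$ is. A total coalition partition of $G$ is a partition $\Psi=\{C_1,\dots,C_k\}$ of $V$ into non-empty classes such that for every $i$ there exists $j\neq i$ such that $C_i$ and $C_j$ form a total coalition. The total coalition number $TC(G)$ of an isolate-free graph $G$ is the maximum cardinality (number of classes) of a total coalition partition of $G$. -}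

module Defs where

open import Data.Fin.Base using (Fin)
open import Data.Fin.Properties using (all?; any?; injective⇒≤) renaming (_≟_ to _≟ᶠ_)
open import Data.Fin.Subset using (Subset; _∈_; _∪_; _∩_; ∣_∣; Nonempty; Empty)
open import Data.Fin.Subset.Properties using (_∈?_; nonempty?; anySubset?; x∈p∩q⁺)
open import Data.List.Base using (allFin; filter; map; upTo)
open import Data.List.Extrema.Nat using (max; argmax-sel; v≤max⁺)
open import Data.List.Membership.Propositional using (lose)
open import Data.List.Membership.Propositional.Properties using (∈-filter⁺; ∈-filter⁻; ∈-upTo⁺)
open import Data.Nat.Base using (ℕ; zero; suc; s≤s; _≤_)
open import Data.Nat.Properties using (≤-reflexive; n≤0⇒n≡0)
open import Data.Product.Base using (∃; _×_; _,_; proj₁; proj₂)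
open import Data.Sum.Base using (inj₁; inj₂)
open import Data.Vec.Base using (Vec; []; _∷_; lookup; tabulate)
open import Function.Base using (id)
open import Relation.Binary.Definitions using (Decidable; Irreflexive; Symmetric)
open import Relation.Binary.PropositionalEquality using (_≡_; _≢_; refl; sym; subst)
open import Relation.Nullary.Decidable using (Dec; yes; no; does; map′; _×-dec_; ¬?)
open import Relation.Nullary.Negation using (¬_; contradiction)
import Relation.Unary as U

private
  variable
    n k : ℕ

record Graph (n : ℕ) : Set₁ where
  field
    Adj    : Fin n → Fin n → Set
    adj?   : Decidable Adj
    symm   : Symmetric Adj
    irrefl : Irreflexive _≡_ Adj

  neighbours : Fin n → Subset n
  neighbours v = tabulate (λ u → does (adj? v u))

  degree : Fin n → ℕ
  degree v = ∣ neighbours v ∣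

  -- The default value 0 is only visible for the graph without vertices.
  maxDegree : ℕ
  maxDegree = max 0 (map degree (allFin n))

  IsolateFree : Set
  IsolateFree = ∀ v → degree v ≢ 0

  TotalDominating : Subset n → Set
  TotalDominating T = ∀ v → ∃ λ u → u ∈ T × Adj v u

  record TotalCoalition (A B : Subset n) : Set where
    constructor mkTotalCoalition
    field
      disjoint : Empty (A ∩ B)
      ¬domˡ    : ¬ TotalDominating A
      ¬domʳ    : ¬ TotalDominating B
      dom-∪    : TotalDominating (A ∪ B)

open Graph public using (maxDegree; IsolateFree; TotalDominating; TotalCoalition)

-- The classes are listed in some order; being non-empty and pairwise
-- disjoint, they are distinct, so k is the cardinality of the partition.
record IsPartition (C : Vec (Subset n) k) : Set where
  constructor mkIsPartition
  field
    nonempty : ∀ i → Nonempty (lookup C i)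
    disjoint : ∀ i j → i ≢ j → Empty (lookup C i ∩ lookup C j)
    covering : ∀ v → ∃ λ i → v ∈ lookup C i

record IsTotalCoalitionPartition (G : Graph n) (C : Vec (Subset n) k) : Set where
  constructor mkIsTotalCoalitionPartition
  field
    isPartition : IsPartition C
    coalition   : ∀ i → ∃ λ j → j ≢ i × TotalCoalition G (lookup C i) (lookup C j)

HasTotalCoalitionPartition : Graph n → ℕ → Set
HasTotalCoalitionPartition {n} G k = ∃ λ (C : Vec (Subset n) k) → IsTotalCoalitionPartition G C

private
  anyVec? : ∀ {A : Set} → (∀ {P : A → Set} → U.Decidable P → Dec (∃ P)) →
            ∀ {k} {P : Vec A k → Set} → U.Decidable P → Dec (∃ P)
  anyVec? anyA? {zero}  P? = map′ ([] ,_) (λ { ([] , p) → p }) (P? [])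
  anyVec? anyA? {suc k} P? =
    map′ (λ { (x , xs , p) → x ∷ xs , p }) (λ { (x ∷ xs , p) → x , xs , p })
         (anyA? (λ x → anyVec? anyA? (λ xs → P? (x ∷ xs))))

totalDominating? : (G : Graph n) → U.Decidable (TotalDominating G)
totalDominating? G T = all? λ v → any? λ u → (u ∈? T) ×-dec Graph.adj? G v u

totalCoalition? : (G : Graph n) → Decidable (TotalCoalition G)
totalCoalition? G A B =
  map′ (λ { (a , b , c , d) → Graph.mkTotalCoalition a b c d })
       (λ { (Graph.mkTotalCoalition a b c d) → a , b , c , d })
       (¬? (nonempty? (A ∩ B)) ×-dec ¬? (totalDominating? G A) ×-dec
        ¬? (totalDominating? G B) ×-dec totalDominating? G (A ∪ B))

isPartition? : U.Decidable (IsPartition {n} {k})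
isPartition? C =
  map′ (λ { (a , b , c) → mkIsPartition a b c })
       (λ { (mkIsPartition a b c) → a , b , c })
       (all? (λ i → nonempty? (lookup C i)) ×-dec
        all? (λ i → all? λ j → disjoint? i j) ×-dec
        all? (λ v → any? λ i → v ∈? lookup C i))
  where
  disjoint? : ∀ i j → Dec (i ≢ j → Empty (lookup C i ∩ lookup C j))
  disjoint? i j with i ≟ᶠ j
  ... | yes i≡j = yes (λ i≢j → contradiction i≡j i≢j)
  ... | no  i≢j = map′ (λ e _ → e) (λ f → f i≢j) (¬? (nonempty? _))

isTotalCoalitionPartition? : (G : Graph n) → U.Decidable (IsTotalCoalitionPartition {n} {k} G)
isTotalCoalitionPartition? G C =
  map′ (λ { (a , b) → mkIsTotalCoalitionPartition a b })
       (λ { (mkIsTotalCoalitionPartition a b) → a , b })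
       (isPartition? C ×-dec
        all? λ i → any? λ j → ¬? (j ≟ᶠ i) ×-dec totalCoalition? G (lookup C i) (lookup C j))

hasTotalCoalitionPartition? : (G : Graph n) → U.Decidable (HasTotalCoalitionPartition G)
hasTotalCoalitionPartition? G k = anyVec? anySubset? (isTotalCoalitionPartition? G)

-- A partition of n vertices has at most n classes, so searching k ≤ n loses
-- nothing; TC-upper and TC-attained confirm that this is the maximum. The
-- value is 0 for a graph without any total coalition partition.
TC : Graph n → ℕ
TC {n} G = max 0 (filter (hasTotalCoalitionPartition? G) (upTo (suc n)))

partition-size≤ : {C : Vec (Subset n) k} → IsPartition C → k ≤ n
partition-size≤ {C = C} (mkIsPartition ne dj _) = injective⇒≤ {f = rep} inj
  where
  rep = λ i → proj₁ (ne i)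

  inj : ∀ {i j} → rep i ≡ rep j → i ≡ j
  inj {i} {j} eq with i ≟ᶠ j
  ... | yes i≡j = i≡j
  ... | no  i≢j = contradiction
    (rep i , x∈p∩q⁺ (proj₂ (ne i) , subst (_∈ lookup C j) (sym eq) (proj₂ (ne j))))
    (dj i j i≢j)

TC-upper : (G : Graph n) → HasTotalCoalitionPartition G k → k ≤ TC G
TC-upper {n} G h@(_ , mkIsTotalCoalitionPartition p _) =
  v≤max⁺ 0 (filter P? (upTo (suc n)))
    (inj₂ (lose (∈-filter⁺ P? (∈-upTo⁺ (s≤s (partition-size≤ p))) h) (≤-reflexive refl)))
  where
  P? = hasTotalCoalitionPartition? G

TC-attained : (G : Graph n) → HasTotalCoalitionPartition G k → HasTotalCoalitionPartition G (TC G)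
TC-attained {n} {k} G h with argmax-sel id 0 (filter (hasTotalCoalitionPartition? G) (upTo (suc n)))
... | inj₂ TC∈ = proj₂ (∈-filter⁻ (hasTotalCoalitionPartition? G) {xs = upTo (suc n)} TC∈)
... | inj₁ TC≡0 = subst (HasTotalCoalitionPartition G) (sym TC≡0)
                    (subst (HasTotalCoalitionPartition G) k≡0 h)
  where
  k≡0 : k ≡ 0
  k≡0 = n≤0⇒n≡0 (subst (k ≤_) TC≡0 (TC-upper G h))

{-# OPTIONS --safe #-}
-- The pairs of classes forming a total coalition are the edges of a graph H
-- without isolated vertices. If A is a class, some vertex v has no neighbour in
-- A, and the classes that meet N(v) form a vertex cover of H of size at most Δ
-- avoiding A. Take a spanning forest of H whose r components are stars with at
-- least one edge. A vertex cover avoiding the centre of a star contains all its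
-- leaves and a vertex of every other star, so every star has at most Δ + 2 - r
-- vertices; hence H has at most r (Δ + 2 - r) ≤ ((Δ + 2) / 2)² vertices.
module Submission where

open import Defs
open import Data.Integer.Base using (+_)
open import Data.Nat.Base as ℕ using (ℕ)
open import Data.Product.Base using (_×_)
open import Data.Rational.Base using (_/_; _≤_; _+_; 1ℚ; +-*-rawSemiring)
open import Algebra.Definitions.RawSemiring +-*-rawSemiring using (_^_)
open import Relation.Binary.PropositionalEquality using (_≡_)

open import Data.Bool.Base using (true; if_then_else_)
open import Data.Fin.Base using (Fin; zero; suc)
open import Data.Fin.Properties using (any?; ¬∀⟶∃¬; _≟_)
open import Data.Fin.Subset using (Subset; inside; outside; ⊤; ⁅_⁆; _∈_; _∉_; _∪_; _∩_; _─_; ∣_∣; Empty)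
import Data.Fin.Subset.Properties as Subset
import Data.Integer.Base as ℤ
import Data.Integer.Properties as ℤ
import Data.Integer.Tactic.RingSolver as ℤ-Solver
open import Data.List.Base using (List; []; _∷_; allFin; filter; map; upTo)
open import Data.List.Extrema.Nat using (argmax-sel; v≤max⁺)
open import Data.List.Membership.Propositional using (lose) renaming (_∈_ to _∈ˡ_)
open import Data.List.Membership.Propositional.Properties using (∈-allFin; ∈-filter⁻; ∈-map⁺)
open import Data.List.Relation.Unary.Any using (here; there)
import Data.Nat.Properties as ℕ
import Data.Nat.Tactic.RingSolver as ℕ-Solver
open import Data.Product.Base using (∃; _,_; proj₁; proj₂; map₂)
import Data.Rational.Base as ℚ
import Data.Rational.Properties as ℚ
open import Data.Rational.Unnormalised.Base using (mkℚᵘ; _≃_; *≤*; 1ℚᵘ) renaming (_*_ to _*ᵘ_; _+_ to _+ᵘ_)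
import Data.Rational.Unnormalised.Properties as ℚᵘ
open import Data.Sum.Base using (_⊎_; inj₁; inj₂; [_,_]′)
open import Data.Vec.Base using ([]; _∷_; lookup; tabulate; here; there)
open import Data.Vec.Functional using (updateAt)
open import Data.Vec.Functional.Properties using (updateAt-updates; updateAt-minimal)
open import Data.Vec.Properties using ([]=⇒lookup; lookup⇒[]=; lookup∘tabulate)
open import Function.Base using (id; const; _∘_)
open import Level using (0ℓ)
open import Relation.Binary.Core using (Rel)
open import Relation.Binary.Definitions using (Symmetric)
open import Relation.Binary.PropositionalEquality using (_≢_; refl; sym; trans; cong; subst; subst₂)
open import Relation.Nullary.Decidable using (Dec; yes; no; does; dec-true; decidable-stable; toSum; _×-dec_; _⊎-dec_; ¬?)
open import Relation.Nullary.Negation using (¬_; contradiction)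
import Relation.Unary as U

private
  variable
    k m n : ℕ

-- Decidable subsets and cardinality bounds

⟪_⟫ : {P : Fin n → Set} → U.Decidable P → Subset n
⟪ P? ⟫ = tabulate (does ∘ P?)

∈⟪⟫⁺ : {P : Fin n → Set} (P? : U.Decidable P) {i : Fin n} → P i → i ∈ ⟪ P? ⟫
∈⟪⟫⁺ P? {i} p = lookup⇒[]= i _ (trans (lookup∘tabulate _ i) (dec-true (P? i) p))

∈⟪⟫⁻ : {P : Fin n → Set} (P? : U.Decidable P) {i : Fin n} → i ∈ ⟪ P? ⟫ → P i
∈⟪⟫⁻ {P = P} P? {i} i∈ = witness (P? i) (trans (sym (lookup∘tabulate _ i)) ([]=⇒lookup i∈))
  where
  witness : (d : Dec (P i)) → does d ≡ true → P i
  witness (yes p) _ = p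

∣p∪q∣+∣p∩q∣≡∣p∣+∣q∣ : (p q : Subset n) → ∣ p ∪ q ∣ ℕ.+ ∣ p ∩ q ∣ ≡ ∣ p ∣ ℕ.+ ∣ q ∣
∣p∪q∣+∣p∩q∣≡∣p∣+∣q∣ []            []            = refl
∣p∪q∣+∣p∩q∣≡∣p∣+∣q∣ (outside ∷ p) (outside ∷ q) = ∣p∪q∣+∣p∩q∣≡∣p∣+∣q∣ p q
∣p∪q∣+∣p∩q∣≡∣p∣+∣q∣ (inside  ∷ p) (outside ∷ q) = cong ℕ.suc (∣p∪q∣+∣p∩q∣≡∣p∣+∣q∣ p q)
∣p∪q∣+∣p∩q∣≡∣p∣+∣q∣ (outside ∷ p) (inside  ∷ q) =
  trans (cong ℕ.suc (∣p∪q∣+∣p∩q∣≡∣p∣+∣q∣ p q)) (sym (ℕ.+-suc ∣ p ∣ ∣ q ∣))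
∣p∪q∣+∣p∩q∣≡∣p∣+∣q∣ (inside  ∷ p) (inside  ∷ q) = cong ℕ.suc
  (trans (ℕ.+-suc ∣ p ∪ q ∣ ∣ p ∩ q ∣)
    (trans (cong ℕ.suc (∣p∪q∣+∣p∩q∣≡∣p∣+∣q∣ p q)) (sym (ℕ.+-suc ∣ p ∣ ∣ q ∣))))

∣p∪q∣≤∣p∣+∣q∣ : (p q : Subset n) → ∣ p ∪ q ∣ ℕ.≤ ∣ p ∣ ℕ.+ ∣ q ∣
∣p∪q∣≤∣p∣+∣q∣ p q = ℕ.≤-trans (ℕ.m≤m+n _ _) (ℕ.≤-reflexive (∣p∪q∣+∣p∩q∣≡∣p∣+∣q∣ p q))

∣p∣≤∣q∣+∣p─q∣ : (p q : Subset n) → ∣ p ∣ ℕ.≤ ∣ q ∣ ℕ.+ ∣ p ─ q ∣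
∣p∣≤∣q∣+∣p─q∣ p q = ℕ.≤-trans (Subset.p⊆q⇒∣p∣≤∣q∣ p⊆) (∣p∪q∣≤∣p∣+∣q∣ q (p ─ q))
  where
  p⊆ : ∀ {i} → i ∈ p → i ∈ q ∪ (p ─ q)
  p⊆ {i} i∈p with i Subset.∈? q
  ... | yes i∈q = Subset.x∈p∪q⁺ (inj₁ i∈q)
  ... | no  i∉q = Subset.x∈p∪q⁺ (inj₂ (Subset.x∈p∧x∉q⇒x∈p─q i∈p i∉q))

p─q⊆∁q : (p q : Subset n) → ∀ {i} → i ∈ p ─ q → i ∉ q
p─q⊆∁q (inside ∷ p) (outside ∷ q) here ()
p─q⊆∁q (_ ∷ p) (outside ∷ q) (there i∈) (there i∈q) = p─q⊆∁q p q i∈ i∈q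
p─q⊆∁q (_ ∷ p) (inside  ∷ q) (there i∈) (there i∈q) = p─q⊆∁q p q i∈ i∈q

-- Induction along `p`: each member `j` removes `R j` from `q` at a cost of at most `M`, and what
-- remains is covered by the later members.
union-bound : (q : Subset k) (p : Subset m) (R : Fin m → Subset k) (M : ℕ) →
              (∀ {i} → i ∈ q → ∃ λ j → j ∈ p × i ∈ R j) →
              (∀ {j} → j ∈ p → ∣ R j ∣ ℕ.≤ M) →
              ∣ q ∣ ℕ.≤ ∣ p ∣ ℕ.* M
union-bound {k} q [] R M q⊆ R≤ = ℕ.≤-reflexive
  (trans (cong ∣_∣ (Subset.Empty-unique λ (_ , i∈q) → nowhere (q⊆ i∈q))) (Subset.∣⊥∣≡0 k))
  where
  nowhere : ∀ {i} → ¬ (∃ λ j → j ∈ [] × i ∈ R j)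
  nowhere (() , _)
union-bound q (outside ∷ p) R M q⊆ R≤ = union-bound q p (R ∘ suc) M (shift ∘ q⊆) (R≤ ∘ there)
  where
  shift : ∀ {i} → (∃ λ j → j ∈ outside ∷ p × i ∈ R j) → ∃ λ j → j ∈ p × i ∈ R (suc j)
  shift (suc j , there j∈p , i∈) = j , j∈p , i∈
union-bound q (inside ∷ p) R M q⊆ R≤ = ℕ.≤-trans (∣p∣≤∣q∣+∣p─q∣ q (R zero))
  (ℕ.+-mono-≤ (R≤ here) (union-bound (q ─ R zero) p (R ∘ suc) M
    (λ i∈ → shift (p─q⊆∁q q (R zero) i∈) (q⊆ (Subset.p─q⊆p q (R zero) i∈))) (R≤ ∘ there)))
  where
  shift : ∀ {i} → i ∉ R zero → (∃ λ j → j ∈ inside ∷ p × i ∈ R j) → ∃ λ j → j ∈ p × i ∈ R (suc j)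
  shift i∉ (zero  , _         , i∈) = contradiction i∈ i∉
  shift i∉ (suc j , there j∈p , i∈) = j , j∈p , i∈

-- The union bound with the singletons `⁅ f j ⁆`. It compares sizes by a surjection, so no injection
-- has to be chosen.
image-bound : (q : Subset k) (p : Subset m) (f : Fin m → Fin k) →
              (∀ {i} → i ∈ q → ∃ λ j → j ∈ p × f j ≡ i) → ∣ q ∣ ℕ.≤ ∣ p ∣
image-bound q p f q⊆ = ℕ.≤-trans
  (union-bound q p (⁅_⁆ ∘ f) 1
    (λ i∈q → map₂ (λ {j} (j∈p , fj≡i) → j∈p , subst (_∈ ⁅ f j ⁆) fj≡i (Subset.x∈⁅x⁆ (f j))) (q⊆ i∈q))
    (λ {j} _ → ℕ.≤-reflexive (Subset.∣⁅x⁆∣≡1 (f j))))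
  (ℕ.≤-reflexive (ℕ.*-identityʳ ∣ p ∣))

-- Spanning star forests

-- A star forest is encoded by the map sending each vertex to the centre of its
-- star; singleton stars are allowed.
record IsStarForest (R : Rel (Fin k) 0ℓ) (c : Fin k → Fin k) : Set where
  field
    idem : ∀ i → c (c i) ≡ c i
    ray  : ∀ i → c i ≢ i → R i (c i)

open IsStarForest

-- In a star forest the first alternative makes `y` a leaf, the second a centre with at least one
-- leaf; the untouched vertices are the singleton stars.
Touched : (Fin k → Fin k) → Fin k → Set
Touched c y = c y ≢ y ⊎ ∃ λ l → c l ≡ y × l ≢ y

touched? : (c : Fin k → Fin k) → U.Decidable (Touched c)
touched? c y = ¬? (c y ≟ y) ⊎-dec any? λ l → c l ≟ y ×-dec ¬? (l ≟ y)

_[_≔_] : (Fin k → Fin k) → Fin k → Fin k → Fin k → Fin k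
c [ x ≔ p ] = updateAt c x (const p)

≔-eq : (c : Fin k → Fin k) (x p : Fin k) → (c [ x ≔ p ]) x ≡ p
≔-eq c x p = updateAt-updates x c

≔-neq : (c : Fin k → Fin k) {x p i : Fin k} → i ≢ x → (c [ x ≔ p ]) i ≡ c i
≔-neq c {x} {p} {i} i≢x = updateAt-minimal i x c i≢x

module _ {R : Rel (Fin k) 0ℓ} {c : Fin k → Fin k} (F : IsStarForest R c) where

  -- The singleton star `x` becomes a leaf at the centre `p`. Nothing else is mapped to `x`, so no
  -- other star changes except that of `p`, which grows.
  attach : ∀ {x p} → ¬ Touched c x → c p ≡ p → R x p → p ≢ x →
           let c′ = c [ x ≔ p ] in
           IsStarForest R c′ × (∀ y → Touched c y → Touched c′ y) × Touched c′ x × Touched c′ p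
  attach {x} {p} ¬tx cp≡p Rxp p≢x =
      record { idem = idem′ ; ray = ray′ } , keep
    , inj₁ (λ e → p≢x (trans (sym at-x) e)) , inj₂ (x , at-x , p≢x ∘ sym)
    where
    c′ = c [ x ≔ p ]
    at-x = ≔-eq c x p

    off-x : ∀ {i} → i ≢ x → c′ i ≡ c i
    off-x = ≔-neq c

    cx≡x : c x ≡ x
    cx≡x = decidable-stable (c x ≟ x) (¬tx ∘ inj₁)

    idem′ : ∀ i → c′ (c′ i) ≡ c′ i
    idem′ i with i ≟ x
    ... | yes refl = trans (cong c′ at-x) (trans (off-x p≢x) (trans cp≡p (sym at-x)))
    -- If `c i` were `x`, then `i` would be a leaf at `x`, which is untouched.
    ... | no  i≢x  = trans (cong c′ (off-x i≢x))
      (trans (off-x λ ci≡x → ¬tx (inj₂ (i , ci≡x , i≢x))) (trans (idem F i) (sym (off-x i≢x))))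

    ray′ : ∀ i → c′ i ≢ i → R i (c′ i)
    ray′ i c′i≢i with i ≟ x
    ... | yes refl = subst (R x) (sym at-x) Rxp
    ... | no  i≢x  = subst (R i) (sym (off-x i≢x)) (ray F i (c′i≢i ∘ trans (off-x i≢x)))

    keep : ∀ y → Touched c y → Touched c′ y
    keep y (inj₁ cy≢y) = inj₁ λ c′y≡y →
      cy≢y (trans (sym (off-x λ { refl → cy≢y cx≡x })) c′y≡y)
    keep y (inj₂ (l , cl≡y , l≢y)) =
      inj₂ (l , trans (off-x λ { refl → l≢y (trans (sym cx≡x) cl≡y) }) cl≡y , l≢y)

  -- The leaf `p` becomes a singleton star. The second leaf `l` keeps the old centre touched, so `p`
  -- alone can lose this property.
  detach : ∀ {p l} → c p ≢ p → l ≢ p → c l ≡ c p → l ≢ c p →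
           let c′ = c [ p ≔ p ] in
           IsStarForest R c′ × (∀ y → y ≢ p → Touched c y → Touched c′ y) ×
           (∀ x → ¬ Touched c x → ¬ Touched c′ x) × c′ p ≡ p
  detach {p} {l} cp≢p l≢p cl≡cp l≢cp =
    record { idem = idem′ ; ray = ray′ } , keep , isolated , at-p
    where
    c′ = c [ p ≔ p ]
    at-p = ≔-eq c p p

    off-p : ∀ {i} → i ≢ p → c′ i ≡ c i
    off-p = ≔-neq c

    ci≢p : ∀ i → c i ≢ p
    ci≢p i ci≡p = cp≢p (trans (cong c (sym ci≡p)) (trans (idem F i) ci≡p))

    idem′ : ∀ i → c′ (c′ i) ≡ c′ i
    idem′ i with i ≟ p
    ... | yes refl = cong c′ at-p
    ... | no  i≢p  = trans (cong c′ (off-p i≢p))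
      (trans (off-p (ci≢p i)) (trans (idem F i) (sym (off-p i≢p))))

    ray′ : ∀ i → c′ i ≢ i → R i (c′ i)
    ray′ i c′i≢i with i ≟ p
    ... | yes refl = contradiction at-p c′i≢i
    ... | no  i≢p  = subst (R i) (sym (off-p i≢p)) (ray F i (c′i≢i ∘ trans (off-p i≢p)))

    keep : ∀ y → y ≢ p → Touched c y → Touched c′ y
    keep y y≢p (inj₁ cy≢y) = inj₁ (cy≢y ∘ trans (sym (off-p y≢p)))
    keep y y≢p (inj₂ (z , cz≡y , z≢y)) with z ≟ p
    ... | no  z≢p  = inj₂ (z , trans (off-p z≢p) cz≡y , z≢y)
    -- Here `y` is the old centre and `p` was its witness; `l` takes over.
    ... | yes refl = inj₂ (l , trans (off-p l≢p) (trans cl≡cp cz≡y) , l≢cp ∘ λ l≡y → trans l≡y (sym cz≡y))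

    isolated : ∀ x → ¬ Touched c x → ¬ Touched c′ x
    isolated x ¬tx (inj₁ c′x≢x) with x ≟ p
    ... | yes refl = c′x≢x at-p
    ... | no  x≢p  = ¬tx (inj₁ (c′x≢x ∘ trans (off-p x≢p)))
    isolated x ¬tx (inj₂ (z , c′z≡x , z≢x)) with z ≟ p
    ... | yes refl = z≢x (trans (sym at-p) c′z≡x)
    ... | no  z≢p  = ¬tx (inj₂ (z , trans (sym (off-p z≢p)) c′z≡x , z≢x))

  -- The star of `p` is a single edge, so exchanging leaf and centre affects no third vertex;
  -- symmetry of `R` makes the old centre a legitimate leaf.
  recentre : ∀ {p} → Symmetric R → c p ≢ p → (∀ l → l ≢ p → c l ≡ c p → l ≡ c p) →
             let c′ = (c [ p ≔ p ]) [ c p ≔ p ] in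
             IsStarForest R c′ × (∀ y → Touched c y → Touched c′ y) ×
             (∀ x → ¬ Touched c x → ¬ Touched c′ x) × c′ p ≡ p
  recentre {p} R-sym cp≢p only-leaf =
    record { idem = idem′ ; ray = ray′ } , keep , isolated , at-p
    where
    q = c p
    c₁ = c [ p ≔ p ]
    c′ = c₁ [ q ≔ p ]

    at-q : c′ q ≡ p
    at-q = ≔-eq c₁ q p

    at-p : c′ p ≡ p
    at-p = trans (≔-neq c₁ (cp≢p ∘ sym)) (≔-eq c p p)

    off : ∀ {i} → i ≢ p → i ≢ q → c′ i ≡ c i
    off i≢p i≢q = trans (≔-neq c₁ i≢q) (≔-neq c i≢p)

    ci≢p : ∀ i → c i ≢ p
    ci≢p i ci≡p = cp≢p (trans (cong c (sym ci≡p)) (trans (idem F i) ci≡p))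

    idem′ : ∀ i → c′ (c′ i) ≡ c′ i
    idem′ i with i ≟ p | i ≟ q
    ... | yes refl | _        = cong c′ at-p
    ... | no _     | yes refl = trans (cong c′ at-q) (trans at-p (sym at-q))
    -- `c i` differs from `p` because a leaf is no value of `c`, and from `q` because `i` would then
    -- be a second leaf.
    ... | no i≢p   | no i≢q   = trans (cong c′ (off i≢p i≢q))
      (trans (off (ci≢p i) (i≢q ∘ only-leaf i i≢p)) (trans (idem F i) (sym (off i≢p i≢q))))

    ray′ : ∀ i → c′ i ≢ i → R i (c′ i)
    ray′ i c′i≢i with i ≟ p | i ≟ q
    ... | yes refl | _        = contradiction at-p c′i≢i
    ... | no _     | yes refl = subst (R q) (sym at-q) (R-sym (ray F p cp≢p))
    ... | no i≢p   | no i≢q   = subst (R i) (sym (off i≢p i≢q)) (ray F i (c′i≢i ∘ trans (off i≢p i≢q)))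

    keep : ∀ y → Touched c y → Touched c′ y
    keep y t with y ≟ p | y ≟ q
    ... | yes refl | _        = inj₂ (q , at-q , cp≢p)
    ... | no _     | yes refl = inj₁ λ e → cp≢p (trans (sym e) at-q)
    keep y (inj₁ cy≢y) | no y≢p | no y≢q = inj₁ (cy≢y ∘ trans (sym (off y≢p y≢q)))
    keep y (inj₂ (l , cl≡y , l≢y)) | no y≢p | no y≢q = inj₂ (l , trans (off l≢p l≢q) cl≡y , l≢y)
      where
      l≢p : l ≢ p
      l≢p refl = y≢q (sym cl≡y)
      l≢q : l ≢ q
      l≢q refl = y≢q (trans (sym cl≡y) (idem F p))

    isolated : ∀ x → ¬ Touched c x → ¬ Touched c′ x
    isolated x ¬tx t with x ≟ p | x ≟ q
    ... | yes refl | _        = ¬tx (inj₁ cp≢p)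
    ... | no x≢p   | yes refl = ¬tx (inj₂ (p , refl , x≢p ∘ sym))
    isolated x ¬tx (inj₁ c′x≢x) | no x≢p | no x≢q = ¬tx (inj₁ (c′x≢x ∘ trans (off x≢p x≢q)))
    isolated x ¬tx (inj₂ (l , c′l≡x , l≢x)) | no x≢p | no x≢q with l ≟ p | l ≟ q
    ... | yes refl | _        = x≢p (trans (sym c′l≡x) at-p)
    ... | no _     | yes refl = x≢p (trans (sym c′l≡x) at-q)
    ... | no l≢p   | no l≢q   = ¬tx (inj₂ (l , trans (sym (off l≢p l≢q)) c′l≡x , l≢x))

-- If p is a leaf, it is first made a centre: it leaves its star when another leaf
-- keeps that star alive, and otherwise the single edge of the star is reversed.
touch : {R : Rel (Fin k) 0ℓ} → Symmetric R → {c : Fin k → Fin k} → IsStarForest R c →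
        ∀ {x p} → R x p → p ≢ x →
        ∃ λ c′ → IsStarForest R c′ × (∀ y → Touched c y → Touched c′ y) × Touched c′ x
touch R-sym {c} F {x} {p} Rxp p≢x with touched? c x
... | yes tx = c , F , (λ _ → id) , tx
... | no ¬tx with c p ≟ p
...   | yes cp≡p = let F′ , keep , tx , _ = attach F ¬tx cp≡p Rxp p≢x in _ , F′ , keep , tx
...   | no  cp≢p with any? (λ l → ¬? (l ≟ p) ×-dec c l ≟ c p ×-dec ¬? (l ≟ c p))
...     | yes (l , l≢p , cl≡cp , l≢cp) =
  let F₁ , keep₁ , iso , fixed = detach F cp≢p l≢p cl≡cp l≢cp
      F₂ , keep₂ , tx , tp     = attach F₁ (iso x ¬tx) fixed Rxp p≢x
  in _ , F₂
   , (λ y ty → [ (λ y≡p → subst (Touched _) (sym y≡p) tp) , (λ y≢p → keep₂ y (keep₁ y y≢p ty)) ]′ (toSum (y ≟ p)))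
   , tx
...     | no  ¬other =
  let only-leaf l l≢p cl≡cp    = decidable-stable (l ≟ c p) λ l≢cp → ¬other (l , l≢p , cl≡cp , l≢cp)
      F₁ , keep₁ , iso , fixed = recentre F R-sym cp≢p only-leaf
      F₂ , keep₂ , tx , _      = attach F₁ (iso x ¬tx) fixed Rxp p≢x
  in _ , F₂ , (λ y → keep₂ y ∘ keep₁ y) , tx

-- Starting from singleton stars, the vertices are touched one at a time; `touch` keeps every
-- earlier vertex touched.
spanningStarForest : {R : Rel (Fin k) 0ℓ} → Symmetric R → (∀ i → ∃ λ j → j ≢ i × R i j) →
                     ∃ λ c → IsStarForest R c × (∀ y → Touched c y)
spanningStarForest {k} {R} R-sym serial = map₂ (map₂ λ t y → t (∈-allFin y)) (go (allFin k))
  where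
  go : (xs : List (Fin k)) → ∃ λ c → IsStarForest R c × (∀ {y} → y ∈ˡ xs → Touched c y)
  go [] = id , record { idem = λ _ → refl ; ray = λ _ i≢i → contradiction refl i≢i } , λ ()
  go (x ∷ xs) =
    let c , F , t            = go xs
        j , j≢x , Rxj        = serial x
        c′ , F′ , keep , tx  = touch R-sym F Rxj j≢x
    in c′ , F′ , λ { (here refl) → tx ; (there y∈) → keep _ (t y∈) }

-- Counting the vertices of a spanning star forest

-- In a star forest a centre belongs to its own star, and the fibre over a leaf is empty.
star : (Fin k → Fin k) → Fin k → Subset k
star c j = ⟪ (λ i → c i ≟ j) ⟫

centres : (Fin k → Fin k) → Subset k
centres c = ⟪ (λ i → c i ≟ i) ⟫

-- The star at `j` and the set of centres share at most `j`, and every other vertex of their union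
-- is the image under `h` of a vertex of `U`.
star-bound : {R : Rel (Fin k) 0ℓ} {c : Fin k → Fin k} → IsStarForest R c → (∀ y → Touched c y) →
             (U : Subset k) → (∀ {i l} → R i l → i ∈ U ⊎ l ∈ U) → ∀ {j} → j ∉ U →
             ∣ star c j ∣ ℕ.+ ∣ centres c ∣ ℕ.≤ ∣ U ∣ ℕ.+ 2
star-bound {R = R} {c} F touched U cover {j} j∉U = begin
  ∣ S ∣ ℕ.+ ∣ T ∣                 ≡⟨ ∣p∪q∣+∣p∩q∣≡∣p∣+∣q∣ S T ⟨
  ∣ S ∪ T ∣ ℕ.+ ∣ S ∩ T ∣         ≤⟨ ℕ.+-mono-≤ S∪T≤ S∩T≤ ⟩
  (1 ℕ.+ ∣ U ∣) ℕ.+ 1             ≡⟨ ℕ-identity ∣ U ∣ ⟩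
  ∣ U ∣ ℕ.+ 2                     ∎
  where
  open ℕ.≤-Reasoning
  S = star c j
  T = centres c

  ℕ-identity : ∀ u → (1 ℕ.+ u) ℕ.+ 1 ≡ u ℕ.+ 2
  ℕ-identity = ℕ-Solver.solve-∀

  S∩T≤ : ∣ S ∩ T ∣ ℕ.≤ 1
  S∩T≤ = ℕ.≤-trans (Subset.p⊆q⇒∣p∣≤∣q∣ λ {i} i∈ →
      let i∈S , i∈T = Subset.x∈p∩q⁻ S T i∈
          i≡j       = trans (sym (∈⟪⟫⁻ (λ i → c i ≟ i) i∈T)) (∈⟪⟫⁻ (λ i → c i ≟ j) i∈S)
      in subst (_∈ ⁅ j ⁆) (sym i≡j) (Subset.x∈⁅x⁆ j))
    (ℕ.≤-reflexive (Subset.∣⁅x⁆∣≡1 j))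

  -- A leaf of the star at j is charged to itself, a centre to a vertex of its star.
  h : Fin _ → Fin _
  h u = if does (c u ≟ j) then u else c u

  h-leaf : ∀ {u} → c u ≡ j → h u ≡ u
  h-leaf {u} cu≡j rewrite dec-true (c u ≟ j) cu≡j = refl

  h-other : ∀ {u i} → c u ≡ i → i ≢ j → h u ≡ i
  h-other {u} refl cu≢j with c u ≟ j
  ... | yes cu≡j = contradiction cu≡j cu≢j
  ... | no  _    = refl

  charge-leaf : ∀ {i} → c i ≡ j → i ≢ j → ∃ λ u → u ∈ U × h u ≡ i
  charge-leaf {i} ci≡j i≢j with cover (subst (R i) ci≡j (ray F i (i≢j ∘ λ ci≡i → trans (sym ci≡i) ci≡j)))
  ... | inj₁ i∈U = i , i∈U , h-leaf ci≡j
  ... | inj₂ j∈U = contradiction j∈U j∉U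

  charge-centre : ∀ {i} → c i ≡ i → i ≢ j → ∃ λ u → u ∈ U × h u ≡ i
  charge-centre {i} ci≡i i≢j with touched i
  ... | inj₁ ci≢i = contradiction ci≡i ci≢i
  -- Whichever end of the edge from `l` to `i` lies in `U`, `h` sends it to `i`, since this is not
  -- the star at `j`.
  ... | inj₂ (l , cl≡i , l≢i) with cover (subst (R l) cl≡i (ray F l (l≢i ∘ λ cl≡l → trans (sym cl≡l) cl≡i)))
  ...   | inj₁ l∈U = l , l∈U , h-other cl≡i i≢j
  ...   | inj₂ i∈U = i , i∈U , h-other ci≡i i≢j

  charge : ∀ {i} → i ∈ (S ∪ T) ─ ⁅ j ⁆ → ∃ λ u → u ∈ U × h u ≡ i
  charge {i} i∈ with Subset.x∉⁅y⁆⇒x≢y (p─q⊆∁q (S ∪ T) ⁅ j ⁆ i∈)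
                   | Subset.x∈p∪q⁻ S T (Subset.p─q⊆p (S ∪ T) ⁅ j ⁆ i∈)
  ... | i≢j | inj₁ i∈S = charge-leaf (∈⟪⟫⁻ (λ i → c i ≟ j) i∈S) i≢j
  ... | i≢j | inj₂ i∈T = charge-centre (∈⟪⟫⁻ (λ i → c i ≟ i) i∈T) i≢j

  S∪T≤ : ∣ S ∪ T ∣ ℕ.≤ 1 ℕ.+ ∣ U ∣
  S∪T≤ = ℕ.≤-trans (∣p∣≤∣q∣+∣p─q∣ (S ∪ T) ⁅ j ⁆)
    (ℕ.+-mono-≤ (ℕ.≤-reflexive (Subset.∣⁅x⁆∣≡1 j)) (image-bound _ U h charge))

-- Optimising over the number of stars

-- For `b = a + d` the two sides differ by the square of `d`; the other order follows by
-- commutativity.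
4ab≤[a+b]² : ∀ a b → 4 ℕ.* (a ℕ.* b) ℕ.≤ (a ℕ.+ b) ℕ.* (a ℕ.+ b)
4ab≤[a+b]² a b = [ ordered , swapped ]′ (ℕ.≤-total a b)
  where
  identity : ∀ a d → (a ℕ.+ (a ℕ.+ d)) ℕ.* (a ℕ.+ (a ℕ.+ d)) ≡ 4 ℕ.* (a ℕ.* (a ℕ.+ d)) ℕ.+ d ℕ.* d
  identity = ℕ-Solver.solve-∀

  ordered : ∀ {a b} → a ℕ.≤ b → 4 ℕ.* (a ℕ.* b) ℕ.≤ (a ℕ.+ b) ℕ.* (a ℕ.+ b)
  ordered {a} {b} a≤b = subst (λ b → 4 ℕ.* (a ℕ.* b) ℕ.≤ (a ℕ.+ b) ℕ.* (a ℕ.+ b)) (ℕ.m+[n∸m]≡n a≤b)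
    (ℕ.≤-trans (ℕ.m≤m+n _ _) (ℕ.≤-reflexive (sym (identity a (b ℕ.∸ a)))))

  swapped : b ℕ.≤ a → 4 ℕ.* (a ℕ.* b) ℕ.≤ (a ℕ.+ b) ℕ.* (a ℕ.+ b)
  swapped b≤a = subst₂ (λ p s → 4 ℕ.* p ℕ.≤ s ℕ.* s) (ℕ.*-comm b a) (ℕ.+-comm b a) (ordered b≤a)

-- The vertices split into `r` stars of at most `d + 2 - r` vertices each, and these two factors add
-- up to `d + 2`.
order-bound : {R : Rel (Fin k) 0ℓ} → Symmetric R → (∀ i → ∃ λ j → j ≢ i × R i j) → (d : ℕ) →
              (∀ j → ∃ λ U → ∣ U ∣ ℕ.≤ d × j ∉ U × (∀ {i l} → R i l → i ∈ U ⊎ l ∈ U)) →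
              4 ℕ.* k ℕ.≤ (d ℕ.+ 2) ℕ.* (d ℕ.+ 2)
order-bound {k} R-sym serial d covers with spanningStarForest R-sym serial
... | c , F , touched = ℕ.≤-trans (ℕ.*-monoʳ-≤ 4 k≤r*M) 4rM≤
  where
  r = ∣ centres c ∣
  M = d ℕ.+ 2 ℕ.∸ r

  star≤ : ∀ j → ∣ star c j ∣ ℕ.≤ M
  star≤ j = let U , U≤d , j∉U , cover = covers j in
    ℕ.m+n≤o⇒m≤o∸n _ (ℕ.≤-trans (star-bound F touched U cover j∉U) (ℕ.+-monoˡ-≤ 2 U≤d))

  k≤r*M : k ℕ.≤ r ℕ.* M
  k≤r*M = ℕ.≤-trans (ℕ.≤-reflexive (sym (Subset.∣⊤∣≡n k)))
    (union-bound ⊤ (centres c) (star c) M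
      (λ {i} _ → c i , ∈⟪⟫⁺ (λ i → c i ≟ i) (idem F i) , ∈⟪⟫⁺ (λ l → c l ≟ c i) refl)
      (λ {j} _ → star≤ j))

  4rM≤ : 4 ℕ.* (r ℕ.* M) ℕ.≤ (d ℕ.+ 2) ℕ.* (d ℕ.+ 2)
  4rM≤ with ℕ.≤-total r (d ℕ.+ 2)
  ... | inj₁ r≤ = subst (λ s → 4 ℕ.* (r ℕ.* M) ℕ.≤ s ℕ.* s) (ℕ.m+[n∸m]≡n r≤) (4ab≤[a+b]² r M)
  -- Truncated subtraction makes `M` zero here.
  ... | inj₂ r≥ rewrite ℕ.m≤n⇒m∸n≡0 r≥ | ℕ.*-zeroʳ r = ℕ.z≤n

-- Total coalitions

totalCoalition-sym : (G : Graph n) → Symmetric (TotalCoalition G)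
totalCoalition-sym G {A} {B} (Graph.mkTotalCoalition disj ¬domA ¬domB dom) =
  Graph.mkTotalCoalition (subst Empty (Subset.∩-comm A B) disj) ¬domB ¬domA
    (subst (TotalDominating G) (Subset.∪-comm A B) dom)

degree≤maxDegree : (G : Graph n) (v : Fin n) → Graph.degree G v ℕ.≤ maxDegree G
degree≤maxDegree {n} G v = v≤max⁺ 0 (map (Graph.degree G) (allFin n))
  (inj₂ (lose (∈-map⁺ (Graph.degree G) (∈-allFin v)) ℕ.≤-refl))

partition-bound : (G : Graph n) → HasTotalCoalitionPartition G k →
                  4 ℕ.* k ℕ.≤ (maxDegree G ℕ.+ 2) ℕ.* (maxDegree G ℕ.+ 2)
partition-bound {n} {k} G (C , mkIsTotalCoalitionPartition part coalition) =
  order-bound (totalCoalition-sym G) coalition (maxDegree G) covers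
  where
  open Graph G using (Adj; adj?; neighbours)

  class : Fin n → Fin k
  class v = proj₁ (IsPartition.covering part v)

  class-unique : ∀ {v i} → v ∈ lookup C i → class v ≡ i
  class-unique {v} {i} v∈ = decidable-stable (class v ≟ i) λ ≢i →
    IsPartition.disjoint part (class v) i ≢i
      (v , Subset.x∈p∩q⁺ (proj₂ (IsPartition.covering part v) , v∈))

  adjacent? : (v : Fin n) (A : Subset n) → Dec (∃ λ u → u ∈ A × Adj v u)
  adjacent? v A = any? λ u → (u Subset.∈? A) ×-dec adj? v u

  undominated : ∀ {A} → ¬ TotalDominating G A → ∃ λ v → ¬ ∃ λ u → u ∈ A × Adj v u
  undominated {A} = ¬∀⟶∃¬ n _ λ v → adjacent? v A

  module _ (v : Fin n) where
    meets? = λ i → adjacent? v (lookup C i)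

    hit : Subset k
    hit = ⟪ meets? ⟫

    -- Each class in `hit` is the class of some neighbour of `v`.
    hit≤ : ∣ hit ∣ ℕ.≤ maxDegree G
    hit≤ = ℕ.≤-trans
      (image-bound hit (neighbours v) class λ i∈ → let u , u∈ , Avu = ∈⟪⟫⁻ meets? i∈ in
        u , ∈⟪⟫⁺ (adj? v) Avu , class-unique u∈)
      (degree≤maxDegree G v)

    -- The union of the two classes dominates `v`, so one of them contains a neighbour of `v`.
    hit-cover : ∀ {i l} → TotalCoalition G (lookup C i) (lookup C l) → i ∈ hit ⊎ l ∈ hit
    hit-cover {i} {l} tc with Graph.TotalCoalition.dom-∪ tc v
    ... | u , u∈ , Avu with Subset.x∈p∪q⁻ (lookup C i) (lookup C l) u∈
    ...   | inj₁ u∈i = inj₁ (∈⟪⟫⁺ meets? (u , u∈i , Avu))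
    ...   | inj₂ u∈l = inj₂ (∈⟪⟫⁺ meets? (u , u∈l , Avu))

  covers : ∀ j → ∃ λ U → ∣ U ∣ ℕ.≤ maxDegree G × j ∉ U ×
           (∀ {i l} → TotalCoalition G (lookup C i) (lookup C l) → i ∈ U ⊎ l ∈ U)
  -- A member of a total coalition is not total dominating; for a vertex `v` that it leaves
  -- undominated, `hit v` avoids `j`.
  covers j = let _ , _ , tc = coalition j
                 v , ¬meets = undominated (Graph.TotalCoalition.¬domˡ tc)
             in hit v , hit≤ v , ¬meets ∘ ∈⟪⟫⁻ (meets? v) , hit-cover v

TC-bound : (G : Graph n) → 4 ℕ.* TC G ℕ.≤ (maxDegree G ℕ.+ 2) ℕ.* (maxDegree G ℕ.+ 2)
TC-bound {n} G with argmax-sel id 0 (filter (hasTotalCoalitionPartition? G) (upTo (ℕ.suc n)))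
-- The maximum takes its default value, as it does when there is no total coalition partition.
... | inj₁ TC≡0 = subst (λ t → 4 ℕ.* t ℕ.≤ (maxDegree G ℕ.+ 2) ℕ.* (maxDegree G ℕ.+ 2)) (sym TC≡0) ℕ.z≤n
... | inj₂ TC∈  = partition-bound G (proj₂ (∈-filter⁻ (hasTotalCoalitionPartition? G) {xs = upTo (ℕ.suc n)} TC∈))

-- Passage to rational numbers

-- Reduces claims about normalised fractions to unnormalised ones, whose numerators and denominators
-- compute. `mkℚᵘ` stores the denominator minus one, so `3` stands for quarters.
toℚᵘ-/ : ∀ i d → ℚ.toℚᵘ (i / ℕ.suc d) ≃ mkℚᵘ i d
toℚᵘ-/ i d = ℚ.toℚᵘ-fromℚᵘ (mkℚᵘ i d)

[m/2]² : ∀ m → (+ m / 2) ^ 2 ≡ + (m ℕ.* m) / 4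
[m/2]² m = ℚ.toℚᵘ-injective (begin
  -- The power `x ^ 2` unfolds with a trailing factor `1ℚ`.
  ℚ.toℚᵘ (x ℚ.* (x ℚ.* 1ℚ))         ≡⟨ cong (λ y → ℚ.toℚᵘ (x ℚ.* y)) (ℚ.*-identityʳ x) ⟩
  ℚ.toℚᵘ (x ℚ.* x)                  ≈⟨ ℚ.toℚᵘ-homo-* x x ⟩
  ℚ.toℚᵘ x *ᵘ ℚ.toℚᵘ x              ≈⟨ ℚᵘ.*-cong (toℚᵘ-/ (+ m) 1) (toℚᵘ-/ (+ m) 1) ⟩
  mkℚᵘ (+ m) 1 *ᵘ mkℚᵘ (+ m) 1      ≡⟨ cong (λ i → mkℚᵘ i 3) (sym (ℤ.pos-* m m)) ⟩
  mkℚᵘ (+ (m ℕ.* m)) 3              ≈⟨ toℚᵘ-/ (+ (m ℕ.* m)) 3 ⟨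
  ℚ.toℚᵘ (+ (m ℕ.* m) / 4)          ∎)
  where
  open ℚᵘ.≃-Reasoning
  x = + m / 2

≤-quarter : ∀ {t m} → 4 ℕ.* t ℕ.≤ m → (+ t / 1) ≤ (+ m / 4)
≤-quarter {t} {m} 4t≤m = ℚ.toℚᵘ-cancel-≤ (begin
  ℚ.toℚᵘ (+ t / 1)  ≃⟨ toℚᵘ-/ (+ t) 0 ⟩
  mkℚᵘ (+ t) 0      ≤⟨ *≤* (subst₂ ℤ._≤_ (ℤ.pos-* t 4) (ℤ.pos-* m 1) (ℤ.+≤+ t*4≤m*1)) ⟩
  mkℚᵘ (+ m) 3      ≃⟨ toℚᵘ-/ (+ m) 3 ⟨
  ℚ.toℚᵘ (+ m / 4)  ∎)
  where
  open ℚᵘ.≤-Reasoning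
  t*4≤m*1 : t ℕ.* 4 ℕ.≤ m ℕ.* 1
  t*4≤m*1 = subst₂ ℕ._≤_ (ℕ.*-comm 4 t) (sym (ℕ.*-identityʳ m)) 4t≤m

[d+2]²/4 : ∀ d → + ((d ℕ.+ 2) ℕ.* (d ℕ.+ 2)) / 4 ≡ (+ (d ℕ.^ 2) / 4) + (+ d / 1) + 1ℚ
[d+2]²/4 d = ℚ.toℚᵘ-injective (begin
  ℚ.toℚᵘ (+ ((d ℕ.+ 2) ℕ.* (d ℕ.+ 2)) / 4)          ≈⟨ toℚᵘ-/ _ 3 ⟩
  mkℚᵘ (+ ((d ℕ.+ 2) ℕ.* (d ℕ.+ 2))) 3              ≡⟨ cong (λ i → mkℚᵘ i 3) numerators ⟩
  (mkℚᵘ (+ (d ℕ.^ 2)) 3 +ᵘ mkℚᵘ (+ d) 0) +ᵘ 1ℚᵘ     ≈⟨ ℚᵘ.+-congˡ 1ℚᵘ (ℚᵘ.+-cong (toℚᵘ-/ (+ (d ℕ.^ 2)) 3) (toℚᵘ-/ (+ d) 0)) ⟨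
  (ℚ.toℚᵘ (+ (d ℕ.^ 2) / 4) +ᵘ ℚ.toℚᵘ (+ d / 1)) +ᵘ 1ℚᵘ  ≈⟨ ℚᵘ.+-congˡ 1ℚᵘ (ℚ.toℚᵘ-homo-+ (+ (d ℕ.^ 2) / 4) (+ d / 1)) ⟨
  ℚ.toℚᵘ ((+ (d ℕ.^ 2) / 4) + (+ d / 1)) +ᵘ 1ℚᵘ     ≈⟨ ℚ.toℚᵘ-homo-+ ((+ (d ℕ.^ 2) / 4) + (+ d / 1)) 1ℚ ⟨
  ℚ.toℚᵘ ((+ (d ℕ.^ 2) / 4) + (+ d / 1) + 1ℚ)       ∎)
  where
  open ℚᵘ.≃-Reasoning

  -- The right side is the numerator that unnormalised addition produces for denominators 4, 1 and
  -- 1.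
  identity : ∀ i → (i ℤ.+ + 2) ℤ.* (i ℤ.+ + 2) ≡ (i ℤ.* i ℤ.* + 1 ℤ.+ i ℤ.* + 4) ℤ.* + 1 ℤ.+ + 1 ℤ.* + 4
  identity = ℤ-Solver.solve-∀

  square : + d ℤ.* + d ≡ + (d ℕ.^ 2)
  square = sym (trans (cong (λ e → + (d ℕ.* e)) (ℕ.*-identityʳ d)) (ℤ.pos-* d d))

  numerators : + ((d ℕ.+ 2) ℕ.* (d ℕ.+ 2)) ≡ (+ (d ℕ.^ 2) ℤ.* + 1 ℤ.+ + d ℤ.* + 4) ℤ.* + 1 ℤ.+ + 1 ℤ.* + 4
  numerators = trans (ℤ.pos-* (d ℕ.+ 2) (d ℕ.+ 2)) (trans (identity (+ d))
    (cong (λ i → (i ℤ.* + 1 ℤ.+ + d ℤ.* + 4) ℤ.* + 1 ℤ.+ + 1 ℤ.* + 4) square))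

theorem3p5 : ∀ {n : ℕ} (G : Graph n) → IsolateFree G →
    let Δ = maxDegree G in
    ((+ TC G / 1) ≤ (+ (Δ ℕ.+ 2) / 2) ^ 2) ×
    ((+ (Δ ℕ.+ 2) / 2) ^ 2 ≡ (+ (Δ ℕ.^ 2) / 4) + (+ Δ / 1) + 1ℚ)
theorem3p5 G _ =
    subst ((+ TC G / 1) ≤_) (sym ([m/2]² s)) (≤-quarter {TC G} (TC-bound G))
  , trans ([m/2]² s) ([d+2]²/4 (maxDegree G))
  where
  s = maxDegree G ℕ.+ 2
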